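{- $\nabla_0:\mathcal{U}\to\mathcal{U}$, with unit $\iota_X:X\to\nabla_0X$, is a higher modality, and a type is $\nabla_0$-modal if and only if it is both a $\neg\neg$-sheaf and $\neg\neg$-separated.
   Context: Setting: homotopy type theory with a univalent universe $\mathcal{U}$ of small types and higher inductive types. It is assumed that there is a small type $\Omega_{\neg\neg}:\mathcal{U}$ with a map $|\cdot|:\Omega_{\neg\neg}\to\mathcal{U}$ such that each $|z|$ is a $\neg\neg$-stable proposition and every $\neg\neg$-stable proposition is $|z|$ for a unique $z$; we identify $z$ with $|z|$. A type $X$ is $\neg\neg$-separated if $\neg\neg(x=y)\to x=y$ for all $x,y:X$. A proposition $P$ is $\neg\neg$-dense if $\neg\neg P$. A type $X$ is a $\neg\neg$-sheaf if for every $\neg\neg$-dense proposition $P$ the constant-function map $X\to X^P$ is an equivalence. For a type $X$, $\nabla_0X$ is the type of $\xi:X\to\Omega_{\neg\neg}$ such that $\neg\neg\sum_{x:X}\xi(x)$ and $\prod_{x,y:X}\xi(x)\to\xi(y)\to\neg\neg(x=y)$. The unit $\iota_X:X\to\nabla_0X$ sends $x$ to $\lambda y.\,\neg\neg(x=y)$. A higher modality is a map $\bigcirc:\mathcal{U}\to\mathcal{U}$ with units $\eta_X:X\to\bigcirc X$, a dependent eliminator $\left(\prod_{x:X}\bigcirc P(\eta x)\right)\to\prod_{z:\bigcirc X}\bigcirc P(z)$ for every $P:\bigcirc X\to\mathcal{U}$ with the computation rule on $\eta$, such that identity types of each $\bigcirc X$ are $\bigcirc$-modal; a type $X$ is $\bigcirc$-modal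 if $\eta_X$ is an equivalence. -}

{-# OPTIONS --without-K #-}
module Defs where

open import Level using (Level; suc; _⊔_)
open import Data.Product using (Σ; Σ-syntax; ∃!; _×_; _,_; proj₁; proj₂)
open import Function.Base using (const; id)
open import Relation.Binary.PropositionalEquality using (_≡_; refl; trans; sym; subst)
open import Relation.Nullary using (¬_; Irrelevant; Stable)

private
  variable
    a b ℓ : Level

-- Equivalences are maps with contractible fibres.  The library's bijections
-- and inverses carry no coherence, so they are not suitable for stating
-- univalence.

IsContr : Set a → Set a
IsContr A = Σ[ c ∈ A ] (∀ x → c ≡ x)

Fiber : {A : Set a} {B : Set b} → (A → B) → B → Set (a ⊔ b)
Fiber {A = A} f y = Σ[ x ∈ A ] f x ≡ y

IsEquiv : {A : Set a} {B : Set b} → (A → B) → Set (a ⊔ b)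
IsEquiv f = ∀ y → IsContr (Fiber f y)

infix 4 _≃_

_≃_ : Set a → Set b → Set (a ⊔ b)
A ≃ B = Σ[ f ∈ (A → B) ] IsEquiv f

id-isEquiv : {A : Set a} → IsEquiv (id {A = A})
id-isEquiv y = (y , refl) , λ { (_ , refl) → refl }

idToEquiv : {A B : Set a} → A ≡ B → A ≃ B
idToEquiv refl = id , id-isEquiv

Univalence : (ℓ : Level) → Set (suc ℓ)
Univalence ℓ = (A B : Set ℓ) → IsEquiv (idToEquiv {A = A} {B = B})

-- Homotopy propositions are the library's `Irrelevant` types.

IsSeparated : Set ℓ → Set ℓ
IsSeparated X = (x y : X) → Stable (x ≡ y)

IsSheaf : Set ℓ → Set (suc ℓ)
IsSheaf {ℓ} X =
  (P : Set ℓ) → Irrelevant P → ¬ ¬ P → IsEquiv (const {A = X} {B = P})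

-- The assumed small type Ω¬¬ of ¬¬-stable propositions.

record StableProps (ℓ : Level) : Set (suc ℓ) where
  field
    Ω        : Set ℓ
    ∣_∣      : Ω → Set ℓ
    isProp   : (z : Ω) → Irrelevant ∣ z ∣
    isStable : (z : Ω) → Stable ∣ z ∣
    classify : (P : Set ℓ) → Irrelevant P → Stable P → ∃! _≡_ (λ z → ∣ z ∣ ≡ P)

-- The library's ⊥ is definitionally proof-irrelevant, so by η any two
-- elements of a negation are definitionally equal, without function
-- extensionality.

¬-isProp : {A : Set a} → Irrelevant (¬ A)
¬-isProp _ _ = refl

¬-isStable : {A : Set a} → Stable (¬ A)
¬-isStable ¬¬¬x x = ¬¬¬x (λ ¬x → ¬x x)

module _ (S : StableProps ℓ) where
  open StableProps S

  ∇₀ : Set ℓ → Set ℓ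
  ∇₀ X =
    Σ[ ξ ∈ (X → Ω) ]
      ¬ ¬ (Σ[ x ∈ X ] ∣ ξ x ∣)
      × (∀ x y → ∣ ξ x ∣ → ∣ ξ y ∣ → ¬ ¬ (x ≡ y))

  -- The element of Ω identified with the ¬¬-stable proposition ¬¬A.

  ⌜¬¬_⌝ : Set ℓ → Ω
  ⌜¬¬ A ⌝ = proj₁ (classify (¬ ¬ A) ¬-isProp ¬-isStable)

  ⌜¬¬⌝-≡ : (A : Set ℓ) → ∣ ⌜¬¬ A ⌝ ∣ ≡ (¬ ¬ A)
  ⌜¬¬⌝-≡ A = proj₁ (proj₂ (classify (¬ ¬ A) ¬-isProp ¬-isStable))

  ι : {X : Set ℓ} → X → ∇₀ X
  ι {X} x = (λ y → ⌜¬¬ x ≡ y ⌝) , inhabited , unique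
    where
    decode : ∀ {y} → ∣ ⌜¬¬ x ≡ y ⌝ ∣ → ¬ ¬ (x ≡ y)
    decode {y} = subst id (⌜¬¬⌝-≡ (x ≡ y))

    inhabited : ¬ ¬ (Σ[ y ∈ X ] ∣ ⌜¬¬ x ≡ y ⌝ ∣)
    inhabited k = k (x , subst id (sym (⌜¬¬⌝-≡ (x ≡ x))) (λ ¬p → ¬p refl))

    unique : ∀ y z → ∣ ⌜¬¬ x ≡ y ⌝ ∣ → ∣ ⌜¬¬ x ≡ z ⌝ ∣ → ¬ ¬ (y ≡ z)
    unique y z p q ¬y≡z =
      decode p (λ x≡y → decode q (λ x≡z → ¬y≡z (trans (sym x≡y) x≡z)))

-- A type X is ○-modal when `IsEquiv (η {X})`.

record IsHigherModality
         (○ : Set ℓ → Set ℓ) (η : {X : Set ℓ} → X → ○ X) : Set (suc ℓ) where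
  field
    elim    : {X : Set ℓ} (P : ○ X → Set ℓ) →
              ((x : X) → ○ (P (η x))) → (z : ○ X) → ○ (P z)
    elim-η  : {X : Set ℓ} (P : ○ X → Set ℓ) (f : (x : X) → ○ (P (η x))) →
              (x : X) → elim P f (η x) ≡ f x
    ≡-modal : {X : Set ℓ} (z w : ○ X) → IsEquiv (η {z ≡ w})

{-# OPTIONS --safe #-}
{-# OPTIONS --without-K #-}

-- Identity types of Ω are equivalent to bi-implications of stable
-- propositions, so Ω, and with it ∇₀ X, is ¬¬-separated and hence a set.
-- A point z of ∇₀ X equals ι x as soon as x satisfies the predicate z, so
-- ¬¬-densely every point is a unit.  The eliminator sends z to the predicate
-- "u is, for some x over z, the transport of a point of f x"; it is unique up
-- to ¬¬ because ∇₀ X is a set.  If X is a separated sheaf, the points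
-- satisfying a given z form a dense proposition, and the sheaf condition
-- extracts the preimage of z; conversely a partial point of X with dense
-- domain is a point of ∇₀ X.

module Submission where

open import Axiom.UniquenessOfIdentityProofs using (UIP; module Constant⇒UIP)
open import Data.Product using (Σ-syntax; _×_; _,_; proj₁; proj₂)
open import Function.Base using (const; id; _∘_)
open import Function.Bundles using (_⇔_; mk⇔)
open import Function.Definitions using (Injective)
open import Level using (Level)
open import Relation.Binary.PropositionalEquality
  using (_≡_; refl; sym; trans; cong; cong-app; subst; subst-sym-subst;
         subst-subst-sym)
open import Relation.Nullary using (¬_; Irrelevant; Stable)
open import Relation.Nullary.Negation using (¬¬-map)

open import Defs

private
  variable
    a b ℓ : Level
    A : Set a
    B : Set b

-- Hedberg's argument: stability rebuilds each path from its double negation, and double negations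
-- are definitionally irrelevant, so the rebuilt path is constant by `refl`.
separated⇒UIP : IsSeparated A → UIP A
separated⇒UIP sep = Constant⇒UIP.≡-irrelevant
  (λ {x} {y} p → sep x y (λ ¬p → ¬p p)) (λ _ _ → refl)

irrelevant⇒UIP : Irrelevant A → UIP A
irrelevant⇒UIP irr = Constant⇒UIP.≡-irrelevant
  (λ {x} {y} _ → irr x y) (λ _ _ → refl)

injective⇒isEquiv : {f : A → B} → UIP B → Injective _≡_ _≡_ f →
                    (∀ y → Fiber f y) → IsEquiv f
injective⇒isEquiv {A = A} {f = f} uip inj fib y = fib y , λ (x , q) →
  fiber-≡ (inj (trans (proj₂ (fib y)) (sym q)))
  where
  fiber-≡ : {x x′ : A} {p : f x ≡ y} {q : f x′ ≡ y} → x ≡ x′ →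
            (x , p) ≡ (x′ , q)
  fiber-≡ refl = cong (_ ,_) (uip _ _)

isEquiv⇒injective : {f : A → B} → IsEquiv f → Injective _≡_ _≡_ f
isEquiv⇒injective {f = f} eq {x} {y} p =
  cong proj₁ (trans (sym (proj₂ (eq (f y)) (x , p))) (proj₂ (eq (f y)) (y , refl)))

module _ (ua : Univalence ℓ) where

  propExt : {A B : Set ℓ} → Irrelevant A → Irrelevant B →
            (A → B) → (B → A) → A ≡ B
  propExt {A} {B} irrA irrB f g = proj₁ (proj₁ (ua A B (f , f-isEquiv)))
    where
    f-isEquiv : IsEquiv f
    f-isEquiv = injective⇒isEquiv (irrelevant⇒UIP irrB) (λ _ → irrA _ _)
      (λ y → g y , irrB _ _)

  -- Univalence presents `e` as the image of a path; once that path is `refl`, `e` is the identity.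
  precompose-injective : {A B C : Set ℓ} (e : A ≃ B) {u v : B → C} →
                         u ∘ proj₁ e ≡ v ∘ proj₁ e → u ≡ v
  precompose-injective {A} {B} e with proj₁ (ua A B e)
  ... | refl , refl = id

  -- Both projections out of the path space of B are retractions of the
  -- diagonal, which is an equivalence; hence they are equal, and any
  -- homotopy factors through them.
  funext : {A B : Set ℓ} {f g : A → B} → (∀ x → f x ≡ g x) → f ≡ g
  funext {A} {B} {f} {g} h =
    cong (λ π x → π (f x , g x , h x))
      (precompose-injective (diagonal , diagonal-isEquiv)
        {u = proj₁} {v = λ t → proj₁ (proj₂ t)} refl)
    where
    diagonal : B → Σ[ x ∈ B ] Σ[ y ∈ B ] x ≡ y
    diagonal x = x , x , refl

    diagonal-isEquiv : IsEquiv diagonal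
    diagonal-isEquiv (x , .x , refl) = (x , refl) , λ { (_ , refl) → refl }

  →-separated : {A B : Set ℓ} → IsSeparated B → IsSeparated (A → B)
  →-separated sep f g ¬¬p =
    funext λ x → sep (f x) (g x) (¬¬-map (λ p → cong-app p x) ¬¬p)

  -- Density of `P` makes `const` injective into a set of functions, so only the extension of a
  -- partial point is left to supply.
  separated⇒sheaf : {X : Set ℓ} → IsSeparated X →
    (∀ (P : Set ℓ) → Irrelevant P → ¬ ¬ P → (f : P → X) →
      Σ[ x ∈ X ] (∀ p → x ≡ f p)) →
    IsSheaf X
  separated⇒sheaf sep extend P irr dense = injective⇒isEquiv
    (separated⇒UIP (→-separated sep))
    (λ {x} {y} c → sep x y (¬¬-map (cong-app c) dense))
    (λ f → let x , h = extend P irr dense f in x , funext h)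

  irrelevant∧stable⇒sheaf : {X : Set ℓ} → Irrelevant X → Stable X → IsSheaf X
  irrelevant∧stable⇒sheaf irr stable =
    separated⇒sheaf (λ x y _ → irr x y) λ _ _ dense f →
      stable (¬¬-map f dense) , λ p → irr _ _

  module _ (S : StableProps ℓ) where
    open StableProps S

    -- By propositional extensionality `z` and `w` both classify `∣ w ∣`, and the classifier is
    -- unique.
    Ω-ext : {z w : Ω} → (∣ z ∣ → ∣ w ∣) → (∣ w ∣ → ∣ z ∣) → z ≡ w
    Ω-ext {z} {w} f g =
      let _ , _ , unique = classify ∣ w ∣ (isProp w) (isStable w)
      in trans (sym (unique (propExt (isProp z) (isProp w) f g))) (unique refl)

    Ω-separated : IsSeparated Ω
    Ω-separated z w ¬¬p = Ω-ext
      (λ s → isStable w (¬¬-map (λ p → subst ∣_∣ p s) ¬¬p))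
      (λ t → isStable z (¬¬-map (λ p → subst ∣_∣ (sym p) t) ¬¬p))

    encode : {A : Set ℓ} → ¬ ¬ A → ∣ ⌜¬¬_⌝ S A ∣
    encode {A} = subst id (sym (⌜¬¬⌝-≡ S A))

    decode : {A : Set ℓ} → ∣ ⌜¬¬_⌝ S A ∣ → ¬ ¬ A
    decode {A} = subst id (⌜¬¬⌝-≡ S A)

    infix 4 _∋_

    _∋_ : {X : Set ℓ} → ∇₀ S X → X → Set ℓ
    z ∋ x = ∣ proj₁ z x ∣

    -- The remaining components of a point of ∇₀ X are negations, hence
    -- definitionally equal.
    ∇₀-≡ : {X : Set ℓ} {z w : ∇₀ S X} → proj₁ z ≡ proj₁ w → z ≡ w
    ∇₀-≡ refl = refl

    ∇₀-ext : {X : Set ℓ} {z w : ∇₀ S X} →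
             (∀ {x} → z ∋ x → w ∋ x) → (∀ {x} → w ∋ x → z ∋ x) → z ≡ w
    ∇₀-ext f g = ∇₀-≡ (funext λ _ → Ω-ext f g)

    ∇₀-separated : {X : Set ℓ} → IsSeparated (∇₀ S X)
    ∇₀-separated z w ¬¬p =
      ∇₀-≡ (→-separated Ω-separated _ _ (¬¬-map (cong proj₁) ¬¬p))

    ∇₀-UIP : {X : Set ℓ} → UIP (∇₀ S X)
    ∇₀-UIP = separated⇒UIP ∇₀-separated

    mk∇₀ : {X : Set ℓ} (Q : X → Set ℓ) → ¬ ¬ (Σ[ x ∈ X ] Q x) →
           (∀ {x y} → Q x → Q y → ¬ ¬ (x ≡ y)) → ∇₀ S X
    mk∇₀ Q inhabited unique =
      (λ x → ⌜¬¬_⌝ S (Q x)) ,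
      ¬¬-map (λ (x , q) → x , encode (λ ¬q → ¬q q)) inhabited ,
      λ x y s t x≢y → decode s λ q → decode t λ r → unique q r x≢y

    -- One inclusion transports `s` along a path known up to double negation, which stability
    -- permits; the other is the uniqueness clause of `z`.
    ∋⇒ι≡ : {X : Set ℓ} (z : ∇₀ S X) {x : X} → z ∋ x → ι S x ≡ z
    ∋⇒ι≡ z@(ξ , _ , unique) {x} s = ∇₀-ext
      (λ {y} t → isStable (ξ y) (¬¬-map (λ x≡y → subst (z ∋_) x≡y s) (decode t)))
      (λ {y} t → encode (unique x y s t))

    ι≡ι⇒¬¬≡ : {X : Set ℓ} {x y : X} → ι S x ≡ ι S y → ¬ ¬ (x ≡ y)
    ι≡ι⇒¬¬≡ {x = x} {y} p =
      decode (subst (_∋ y) (sym p) (encode (λ y≢y → y≢y refl)))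

    ι-injective : {X : Set ℓ} → IsSeparated X → Injective _≡_ _≡_ (ι S {X})
    ι-injective sep p = sep _ _ (ι≡ι⇒¬¬≡ p)

    module _ {X : Set ℓ} (P : ∇₀ S X → Set ℓ) (f : (x : X) → ∇₀ S (P (ι S x))) where

      -- Pulling `u` back along `p` makes the case `p = refl` reduce to `f x ∋ u`.
      Reaches : (z : ∇₀ S X) → P z → Set ℓ
      Reaches z u =
        Σ[ x ∈ X ] Σ[ p ∈ ι S x ≡ z ] f x ∋ subst P (sym p) u

      reaches-inhabited : ∀ z → ¬ ¬ (Σ[ u ∈ P z ] Reaches z u)
      reaches-inhabited z@(_ , inhabited , _) k = inhabited λ (x , s) →
        let p = ∋⇒ι≡ z s in
        proj₁ (proj₂ (f x)) λ (v , t) →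
          k (subst P p v , x , p ,
             subst (f x ∋_) (sym (subst-sym-subst p)) t)

      reaches-unique : ∀ z {u v} → Reaches z u → Reaches z v → ¬ ¬ (u ≡ v)
      reaches-unique z {u} {v} (x , p , s) (y , q , t) u≢v =
        ι≡ι⇒¬¬≡ (trans p (sym q)) λ { refl → same-point q t }
        where
        same-point : (q : ι S x ≡ z) → ¬ (f x ∋ subst P (sym q) v)
        -- With `x` and `y` identified, the two paths agree, so uniqueness in `f x` compares the
        -- pulled-back points.
        same-point q t with ∇₀-UIP p q
        ... | refl = proj₂ (proj₂ (f x)) _ _ s t λ e →
          u≢v (trans (sym (subst-subst-sym p))
            (trans (cong (subst P p) e) (subst-subst-sym p)))

      ∇₀-elim : (z : ∇₀ S X) → ∇₀ S (P z)
      ∇₀-elim z = mk∇₀ (Reaches z) (reaches-inhabited z) (reaches-unique z)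

      reaches-ι : ∀ {x u} → Reaches (ι S x) u → ¬ ¬ (f x ∋ u)
      reaches-ι {x} {u} (y , p , s) ¬t = ι≡ι⇒¬¬≡ p λ { refl → same-point p s }
        -- Over a common base point `p` is a loop in the set `∇₀ S X`, hence trivial.
        where
        same-point : (p : ι S x ≡ ι S x) → ¬ (f x ∋ subst P (sym p) u)
        same-point p s with ∇₀-UIP p refl
        ... | refl = ¬t s

      ∇₀-elim-ι : ∀ x → ∇₀-elim (ι S x) ≡ f x
      ∇₀-elim-ι x = ∇₀-ext
        (λ {u} s → isStable (proj₁ (f x) u) λ ¬t → decode s λ r → reaches-ι r ¬t)
        (λ t → encode λ ¬r → ¬r (x , refl , t))

    modal⇒separated : {X : Set ℓ} → IsEquiv (ι S {X}) → IsSeparated X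
    modal⇒separated eq x y ¬¬p =
      isEquiv⇒injective eq (∇₀-separated _ _ (¬¬-map (cong (ι S)) ¬¬p))

    modal⇒sheaf : {X : Set ℓ} → IsEquiv (ι S {X}) → IsSheaf X
    modal⇒sheaf {X} eq = separated⇒sheaf (modal⇒separated eq) extend
      where
      extend : (P : Set ℓ) → Irrelevant P → ¬ ¬ P → (f : P → X) →
               Σ[ x ∈ X ] (∀ p → x ≡ f p)
      extend P irr dense f =
        let (x , ιx≡z) , _ = eq z
        in x , λ p → isEquiv⇒injective eq
             (trans ιx≡z (sym (∋⇒ι≡ z (encode λ k → k (p , refl)))))
        where
        z : ∇₀ S X
        -- This is the image of `f`: density of `P` inhabits it, and irrelevance of `P` makes it
        -- single-valued.
        z = mk∇₀ (Fiber f) (¬¬-map (λ p → f p , p , refl) dense)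
          λ { (p , refl) (q , refl) fp≢fq → fp≢fq (cong f (irr p q)) }

    sheaf∧separated⇒modal : {X : Set ℓ} → IsSheaf X → IsSeparated X →
                            IsEquiv (ι S {X})
    sheaf∧separated⇒modal {X} sheaf sep =
      injective⇒isEquiv ∇₀-UIP (ι-injective sep) fiber
      where
      fiber : (z : ∇₀ S X) → Fiber (ι S) z
      fiber z@(ξ , inhabited , unique) =
        let (x , c) , _ = sheaf (Σ[ x ∈ X ] z ∋ x) irr inhabited proj₁
        -- The equation is stable, so some `y` satisfying `z` may be assumed, and `c` identifies it
        -- with `x`.
        in x , ∇₀-separated _ _ (¬¬-map
             (λ (y , s) → ∋⇒ι≡ z (subst (z ∋_) (sym (cong-app c (y , s))) s))
             inhabited)
        where
        irr : Irrelevant (Σ[ x ∈ X ] z ∋ x)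
        irr (x , s) (y , t) with sep x y (unique x y s t)
        ... | refl = cong (x ,_) (isProp (ξ x) s t)

    ∇₀-isHigherModality : IsHigherModality (∇₀ S) (ι S)
    ∇₀-isHigherModality = record
      { elim    = ∇₀-elim
      ; elim-η  = ∇₀-elim-ι
      -- Identity types of `∇₀ S X` are stable propositions, hence separated sheaves.
      ; ≡-modal = λ z w → sheaf∧separated⇒modal
          (irrelevant∧stable⇒sheaf ∇₀-UIP (∇₀-separated z w))
          (λ p q _ → ∇₀-UIP p q)
      }

mainTheorem1 : {ℓ : Level} → Univalence ℓ → (S : StableProps ℓ) →
    IsHigherModality (∇₀ S) (ι S)
    × ((X : Set ℓ) → IsEquiv (ι S {X}) ⇔ (IsSheaf X × IsSeparated X))
mainTheorem1 ua S = ∇₀-isHigherModality ua S , λ X →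
  mk⇔ (λ eq → modal⇒sheaf ua S eq , modal⇒separated ua S eq)
      (λ (sheaf , sep) → sheaf∧separated⇒modal ua S sheaf sep)
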